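{- Let $\alpha$ be an infinite permutation (that is, an $\mathbb N$-permutation). Then $\alpha$ is not ultimately periodic if and only if $p^*_{\alpha}(n)\geq n$ for every integer $n\geq 1$.
   Context: $\mathbb N=\{0,1,2,\dots\}$. For $S\subseteq\mathbb N$, an $S$-permutation $\alpha$ is an equivalence class of sequences $(a_s)_{s\in S}$ of pairwise distinct real numbers, where $(a_s)\sim(b_s)$ if and only if for all $s,r\in S$ one has $a_s<a_r \iff b_s<b_r$. Equivalently, it is a linear ordering of the index set $S$; we write $\alpha_i<\alpha_j$ or $\alpha_i>\alpha_j$ for this order. An infinite permutation is an $\mathbb N$-permutation. For $i\ne j$ let $\gamma_{ij}\in\{<,>\}$ be the relation such that $\alpha_i\,\gamma_{ij}\,\alpha_j$. An $\mathbb N$-permutation $\alpha$ is ultimately $t$-periodic ($t\ge 1$) if there is $n_0$ such that $\gamma_{ij}=\gamma_{i+t,j+t}$ for all $i\neq j$ with $i,j>n_0$; it is ultimately periodic if it is ultimately $t$-periodic for some $t\geq 1$. A window is a finite set $T=\{0,m_1,\dots,m_{k-1}\}\subset\mathbb N$ with $0<m_1<\dots<m_{k-1}$; $\#T=k$ is its cardinality. For $n\in\mathbb N$ the $T$-factor $\alpha_{T+n}$ is the restriction of $\alpha$ to $T+n$, regarded as a permutation on $T$ (via the shift by $n$). The number of distinct $T$-factors of $\alpha$ is denoted $p_\alpha(T)$. The maximal pattern complexity of $\alpha$ is $p^*_\alpha(n)=\max_{\#T=n}p_\alpha(T)$, the maximum over all windows $T$ of cardinality $n$. -}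

module Defs where

open import Data.Fin using (Fin) renaming (_<_ to _<ᶠ_)
import Data.Fin.Properties as Fin
open import Data.Nat using (ℕ; _+_; _<_; _≤_)
open import Data.Nat.Properties using (+-cancelʳ-≡; <⇒≢)
open import Data.Product using (∃-syntax; _×_)
open import Data.Empty using (⊥-elim)
open import Function using (_on_)
open import Function.Bundles using (_⇔_; Bijection)
open import Function.Construct.Identity using (⇔-id)
open import Function.Construct.Symmetry using (⇔-sym)
open import Function.Construct.Composition using (_⇔-∘_)
open import Function.Definitions using (Injective)
open import Level using (0ℓ; suc)
open import Relation.Binary.Bundles using (Setoid)
open import Relation.Binary.Core using (Rel)
open import Relation.Binary.Definitions using (Tri; tri<; tri≈; tri>)
open import Relation.Binary.PropositionalEquality using (_≡_; _≢_; refl; sym; cong; setoid; isEquivalence; resp₂)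
open import Relation.Binary.Structures using (IsStrictTotalOrder)
import Relation.Binary.Construct.On as On

-- A permutation is represented by the linear order it induces on its index
-- set, so equality of permutations is the equivalence _≈_ below, not _≡_.
record Permutation (I : Set) : Set₁ where
  field
    _≺_                : Rel I 0ℓ
    isStrictTotalOrder : IsStrictTotalOrder _≡_ _≺_

  open IsStrictTotalOrder isStrictTotalOrder public
    using (compare; irrefl; trans)

_≈_ : ∀ {I} → Rel (Permutation I) 0ℓ
α ≈ β = ∀ i j → (i ≺ᵅ j) ⇔ (i ≺ᵝ j)
  where
  open Permutation α using () renaming (_≺_ to _≺ᵅ_)
  open Permutation β using () renaming (_≺_ to _≺ᵝ_)

permutationSetoid : Set → Setoid (suc 0ℓ) 0ℓ
permutationSetoid I = record
  { Carrier       = Permutation I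
  ; _≈_           = _≈_
  ; isEquivalence = record
    { refl  = λ i j → ⇔-id _
    ; sym   = λ p i j → ⇔-sym (p i j)
    ; trans = λ p q i j → q i j ⇔-∘ p i j
    }
  }

InfinitePermutation : Set₁
InfinitePermutation = Permutation ℕ

restrict : ∀ {I J} (f : J → I) → Injective _≡_ _≡_ f → Permutation I → Permutation J
restrict f f-inj α = record
  { _≺_                = _≺_ on f
  ; isStrictTotalOrder = record
    { isStrictPartialOrder = record
      { isEquivalence = isEquivalence
      ; irrefl        = λ where refl → irrefl refl
      ; trans         = trans
      ; <-resp-≈      = resp₂ (_≺_ on f)
      }
    ; compare = λ i j → pullback (compare (f i) (f j))
    }
  }
  where
  open Permutation α
  pullback : ∀ {i j} → Tri (f i ≺ f j) (f i ≡ f j) (f j ≺ f i) →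
             Tri (f i ≺ f j) (i ≡ j) (f j ≺ f i)
  pullback (tri< a ¬b ¬c) = tri< a (λ e → ¬b (cong f e)) ¬c
  pullback (tri≈ ¬a b ¬c) = tri≈ ¬a (f-inj b) ¬c
  pullback (tri> ¬a ¬b c) = tri> ¬a (λ e → ¬b (cong f e)) c

-- For i ≢ j the relation γᵢⱼ ∈ {<,>} is determined by whether i ≺ j holds, so
-- γᵢⱼ = γᵢ₊ₜ,ⱼ₊ₜ unfolds to the equivalence below.
UltimatelyPeriodicWith : InfinitePermutation → ℕ → Set
UltimatelyPeriodicWith α t =
  ∃[ n₀ ] (∀ i j → i ≢ j → n₀ < i → n₀ < j → (i ≺ j) ⇔ ((i + t) ≺ (j + t)))
  where open Permutation α

UltimatelyPeriodic : InfinitePermutation → Set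
UltimatelyPeriodic α = ∃[ t ] 1 ≤ t × UltimatelyPeriodicWith α t

-- A window of cardinality k, given by its increasing enumeration.
record Window (k : ℕ) : Set where
  field
    elem       : Fin k → ℕ
    increasing : ∀ {i j} → i <ᶠ j → elem i < elem j
    contains-0 : ∃[ i ] elem i ≡ 0

  elem-injective : Injective _≡_ _≡_ elem
  elem-injective {i} {j} eq with Fin.<-cmp i j
  ... | tri< i<j _ _ = ⊥-elim (<⇒≢ (increasing i<j) eq)
  ... | tri≈ _ i≡j _ = i≡j
  ... | tri> _ _ j<i = ⊥-elim (<⇒≢ (increasing j<i) (sym eq))

-- The T-factor at n, with T identified with Fin k through its enumeration.
factor : ∀ {k} → InfinitePermutation → Window k → ℕ → Permutation (Fin k)
factor α T n =
  restrict (λ i → elem i + n) (λ eq → elem-injective (+-cancelʳ-≡ n _ _ eq)) α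
  where open Window T

-- The set of T-factors of α, as positions n ∈ ℕ identified when their
-- T-factors agree.
factorSetoid : ∀ {k} → InfinitePermutation → Window k → Setoid 0ℓ 0ℓ
factorSetoid α T = On.setoid (permutationSetoid _) (factor α T)

-- p_α(T) = c. This is a relation because counting the T-factors of an
-- arbitrary α is not computable.
PatternComplexity : ∀ {k} → InfinitePermutation → Window k → ℕ → Set
PatternComplexity α T c = Bijection (setoid (Fin c)) (factorSetoid α T)

-- p*_α(n) = m, where m is an attained upper bound of the values p_α(T).
MaximalPatternComplexity : InfinitePermutation → ℕ → ℕ → Set
MaximalPatternComplexity α n m =
  (∃[ T ] PatternComplexity {n} α T m) ×
  (∀ (T : Window n) c → PatternComplexity α T c → c ≤ m)

{-# OPTIONS --safe #-}
module Submission where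

-- Suppose that no window of size n has n factors. Call m ↦ γ_{i,i+m} the row
-- of i. Starting from the window {0}, add as long as possible an index m at
-- which two rows that agree on the window differ: each addition creates a new
-- factor, so this stops at a window W on which every row is determined by its
-- restriction. For fixed d the word i ↦ γ_{i,i+d} is ultimately periodic: this
-- is the Morse–Hedlund argument along the window {0,d,…,(n−1)d}. A common
-- period of these words for d ∈ W is then a period of the rows, hence of α.

open import Axiom.ExcludedMiddle using (ExcludedMiddle)
open import Data.Fin using (Fin; zero; suc; toℕ; fromℕ<; inject≤; funToFin; finToFun)
  renaming (_<_ to _<ᶠ_)
import Data.Fin.Properties as Fin
open import Data.Nat using (ℕ; zero; suc; NonZero; >-nonZero⁻¹; _≤_; _<_; _+_; _*_; _∸_; _^_; _!; _⊔_; z≤n; s≤s; z<s)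
open import Data.Nat.Divisibility using (_∣_; divides; ∣-trans; m∣m*n; m≤n⇒m!∣n!)
open import Data.Nat.Induction using (<-rec)
open import Data.Nat.Properties
open import Data.Nat.Tactic.RingSolver using (solve-∀)
open import Data.Product using (∃; ∃-syntax; _×_; _,_; proj₁; proj₂)
open import Data.Sum using (_⊎_; inj₁; inj₂)
open import Data.Vec.Functional using (_∷_)
open import Function using (_∘_; case_of_)
open import Function.Bundles using (_⇔_; mk⇔; Equivalence; Bijection)
open import Function.Construct.Composition using (_⇔-∘_)
open import Function.Construct.Identity using (⇔-id)
open import Function.Construct.Symmetry using (⇔-sym)
open import Function.Definitions using (Injective)
open import Level using (0ℓ)
open import Relation.Binary.Bundles using (Setoid)
open import Relation.Binary.Core using (Rel; _⇒_)
open import Relation.Binary.Definitions using (Symmetric; tri<; tri≈; tri>)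
open import Relation.Binary.PropositionalEquality
  using (_≡_; _≢_; refl; sym; trans; cong; cong₂; subst; subst₂; module ≡-Reasoning)
open import Relation.Nullary using (¬_; yes; no; contradiction)
open import Relation.Nullary.Decidable using (decidable-stable)
open import Relation.Unary using (Pred; _⊆_)
open import Defs

-- Counting equivalence classes from below by pairwise inequivalent positions.

Separated : Rel ℕ 0ℓ → ℕ → Set
Separated R c = ∃[ f ] Injective (_≡_ {A = Fin c}) R f

separated-mono : ∀ {R S : Rel ℕ 0ℓ} {c} → (∀ {i j} → S i j → R i j) → Separated R c → Separated S c
separated-mono S⇒R (f , inj) = f , λ s → inj (S⇒R s)

separated-≤ : ∀ {R c d} → c ≤ d → Separated R d → Separated R c
separated-≤ c≤d (f , inj) =
  (λ x → f (inject≤ x c≤d)) , λ r → Fin.inject≤-injective c≤d c≤d _ _ (inj r)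

separated-∷ : ∀ {R c} → Symmetric R → ((f , _) : Separated R c) →
              ∀ y → (∀ x → ¬ R (f x) y) → Separated R (suc c)
separated-∷ {R} {c} sym-R (f , inj) y new = y ∷ f , inj′
  where
  inj′ : Injective (_≡_ {A = Fin (suc c)}) R (y ∷ f)
  inj′ {zero}  {zero}  r = refl
  inj′ {zero}  {suc x} r = contradiction (sym-R r) (new x)
  inj′ {suc x} {zero}  r = contradiction r (new x)
  inj′ {suc x} {suc z} r = cong suc (inj r)

separated-bounded : ∀ {R b c} (g : ℕ → Fin b) → (∀ {i j} → g i ≡ g j → R i j) →
                    Separated R c → c ≤ b
separated-bounded g g-reflects (f , inj) = Fin.injective⇒≤ (inj ∘ g-reflects)

-- Read `P l i` as letter `l` of a word attached to `i`; words are compared only at the places in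
-- `D`. A record, unlike a bare function type, lets `P` and `D` be inferred.
record Agree (P : ℕ → ℕ → Set) (D : Pred ℕ 0ℓ) (i j : ℕ) : Set where
  constructor agree
  field at : ∀ l → D l → P l i ⇔ P l j
open Agree

agree-sym : ∀ {P D} → Symmetric (Agree P D)
agree-sym r = agree λ l l∈D → ⇔-sym (at r l l∈D)

agree-trans : ∀ {P D i j k} → Agree P D i j → Agree P D j k → Agree P D i k
agree-trans r s = agree λ l l∈D → at s l l∈D ⇔-∘ at r l l∈D

-- Increasing sequences and windows.

Increasing : ∀ {k} → (Fin k → ℕ) → Set
Increasing s = ∀ {i j} → i <ᶠ j → s i < s j

_∈ₛ_ : ∀ {k} → ℕ → (Fin k → ℕ) → Set
m ∈ₛ s = ∃[ i ] s i ≡ m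

increasing-∷ : ∀ {k x} {s : Fin k → ℕ} → (∀ i → x < s i) → Increasing s → Increasing (x ∷ s)
increasing-∷ x< inc {zero}  {suc j} _         = x< j
increasing-∷ x< inc {suc i} {suc j} (s≤s i<j) = inc i<j
increasing-∷ x< inc {_}     {zero}  ()

-- The last component limits the new terms to `m` and the old ones; the recursion needs it to keep
-- the head below the enlarged tail.
insert : ∀ {k} (s : Fin k → ℕ) m → Increasing s → ¬ m ∈ₛ s →
         ∃[ s′ ] Increasing {suc k} s′ × m ∈ₛ s′ × (∀ i → s i ∈ₛ s′) ×
                 (∀ i → s′ i ≡ m ⊎ s′ i ∈ₛ s)
insert {zero} s m inc m∉s =
  (λ _ → m) , (λ { {zero} {zero} () }) , (zero , refl) , (λ ()) , λ _ → inj₁ refl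
insert {suc k} s m inc m∉s with <-cmp m (s zero)
... | tri≈ _ m≡s₀ _ = contradiction (zero , sym m≡s₀) m∉s
... | tri< m<s₀ _ _ = m ∷ s , increasing-∷ m< inc , (zero , refl) , (λ i → suc i , refl) , origin
  where
  m< : ∀ i → m < s i
  m< zero    = m<s₀
  m< (suc i) = <-trans m<s₀ (inc z<s)
  origin : ∀ i → (m ∷ s) i ≡ m ⊎ (m ∷ s) i ∈ₛ s
  origin zero    = inj₁ refl
  origin (suc i) = inj₂ (i , refl)
... | tri> _ _ s₀<m
  with insert (s ∘ suc) m (inc ∘ s≤s) (λ (i , e) → m∉s (suc i , e))
... | s′ , inc′ , (p , s′p≡m) , s⊆s′ , origin′ =
  s zero ∷ s′ , increasing-∷ s₀< inc′ , (suc p , s′p≡m) , s⊆ , origin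
  where
  s₀< : ∀ i → s zero < s′ i
  s₀< i with origin′ i
  ... | inj₁ e       = subst (s zero <_) (sym e) s₀<m
  ... | inj₂ (j , e) = subst (s zero <_) e (inc z<s)
  s⊆ : ∀ i → s i ∈ₛ (s zero ∷ s′)
  s⊆ zero    = zero , refl
  s⊆ (suc i) = let j , e = s⊆s′ i in suc j , e
  origin : ∀ i → (s zero ∷ s′) i ≡ m ⊎ (s zero ∷ s′) i ∈ₛ s
  origin zero = inj₂ (zero , refl)
  origin (suc i) with origin′ i
  ... | inj₁ e       = inj₁ e
  ... | inj₂ (j , e) = inj₂ (suc j , e)

sequence-bounded : ∀ {k} (s : Fin k → ℕ) → ∃[ L ] (∀ i → s i ≤ L)
sequence-bounded {zero}  s = 0 , λ ()
sequence-bounded {suc k} s =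
  let L , s≤L = sequence-bounded (s ∘ suc)
  in s zero ⊔ L , λ { zero    → m≤m⊔n (s zero) L
                    ; (suc i) → ≤-trans (s≤L i) (m≤n⊔m (s zero) L) }

_∈ʷ_ : ∀ {k} → ℕ → Window k → Set
m ∈ʷ W = m ∈ₛ Window.elem W

insert-window : ∀ {k} (W : Window k) m → ¬ m ∈ʷ W →
                ∃ λ (W′ : Window (suc k)) → (_∈ʷ W) ⊆ (_∈ʷ W′) × m ∈ʷ W′
insert-window W m m∉W with insert (Window.elem W) m (Window.increasing W) m∉W
... | s′ , inc′ , m∈s′ , W⊆s′ , _ =
  record { elem = s′ ; increasing = inc′ ; contains-0 = W⊆ (Window.contains-0 W) }
  , W⊆ , m∈s′
  where
  W⊆ : (_∈ʷ W) ⊆ (_∈ₛ s′)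
  W⊆ (i , refl) = W⊆s′ i

singleton-window : Window 1
singleton-window = record
  { elem       = λ _ → 0
  ; increasing = λ { {zero} {zero} () }
  ; contains-0 = zero , refl
  }

arithmetic-window : ∀ k d .{{_ : NonZero d}} → Window (suc k)
arithmetic-window k d = record
  { elem       = λ i → toℕ i * d
  ; increasing = *-monoˡ-< d
  ; contains-0 = zero , refl
  }

∣! : ∀ {m n} → 1 ≤ m → m ≤ n → m ∣ n !
∣! {suc m} _ m≤n = ∣-trans (m∣m*n (m !)) (m≤n⇒m!∣n! m≤n)

SameFactor : ∀ {k} → InfinitePermutation → Window k → Rel ℕ 0ℓ
SameFactor α T = Setoid._≈_ (factorSetoid α T)

separated-bijection : ∀ {k c} {α} {T : Window k} →
                      PatternComplexity α T c → Separated (SameFactor α T) c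
separated-bijection b = Bijection.to b , Bijection.injective b

-- Ultimate periodicity bounds the number of factors.

module _ (α : InfinitePermutation) where
  open Permutation α using (_≺_; irrefl)

  sameFactor-+period : ∀ {t n₀} →
    (∀ i j → i ≢ j → n₀ < i → n₀ < j → (i ≺ j) ⇔ ((i + t) ≺ (j + t))) →
    ∀ {k} (T : Window k) {n} → n₀ < n → SameFactor α T (n + t) n
  sameFactor-+period {t} per T {n} n₀<n a b
    rewrite sym (+-assoc (Window.elem T a) n t) | sym (+-assoc (Window.elem T b) n t)
    with Window.elem T a + n ≟ Window.elem T b + n
  ... | no i≢j = ⇔-sym (per _ _ i≢j (≤-trans n₀<n (m≤n+m n _)) (≤-trans n₀<n (m≤n+m n _)))
  -- Periodicity speaks of distinct indices; for equal ones both relations fail by irreflexivity.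
  ... | yes i≡j = mk⇔ (absurd (cong (_+ t) i≡j)) (absurd i≡j)
    where
    absurd : ∀ {x y} {A : Set} → x ≡ y → x ≺ y → A
    absurd x≡y x≺y = contradiction x≺y (irrefl x≡y)

  -- Moving a position above `n₀ + t` back by `t` keeps its factor, so the positions below
  -- `suc n₀ + t` represent all factors, whatever the window.
  periodic⇒bounded : UltimatelyPeriodic α →
                     ∃[ b ] (∀ {k} (T : Window k) {c} → Separated (SameFactor α T) c → c ≤ b)
  periodic⇒bounded (t , 1≤t , n₀ , per) = suc n₀ + t , λ T →
    separated-bounded {SameFactor α T} (proj₁ ∘ representative T) λ {i} {j} eq →
      ~-trans T (~-sym T (proj₂ (representative T i)))
        (subst (λ r → SameFactor α T (toℕ r) j) (sym eq) (proj₂ (representative T j)))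
    where
    ~-sym : ∀ {k} (T : Window k) → Symmetric (SameFactor α T)
    ~-sym T = Setoid.sym (factorSetoid α T)
    ~-trans : ∀ {k} (T : Window k) {i j l} →
              SameFactor α T i j → SameFactor α T j l → SameFactor α T i l
    ~-trans T {i} {j} {l} = Setoid.trans (factorSetoid α T) {i} {j} {l}
    representative : ∀ {k} (T : Window k) x →
                     ∃ λ (r : Fin (suc n₀ + t)) → SameFactor α T (toℕ r) x
    representative T = <-rec _ λ x rec → reduce x rec
      where
      reduce : ∀ x → (∀ {y} → y < x → ∃ λ (r : Fin (suc n₀ + t)) → SameFactor α T (toℕ r) y) →
               ∃ λ (r : Fin (suc n₀ + t)) → SameFactor α T (toℕ r) x
      reduce x rec with x <? suc n₀ + t
      ... | yes x<b = fromℕ< x<b , subst (λ y → SameFactor α T y x) (sym (Fin.toℕ-fromℕ< x<b))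
                                     (Setoid.refl (factorSetoid α T) {x})
      ... | no x≮b =
        let b≤x   = ≮⇒≥ x≮b
            t≤x   = ≤-trans (m≤n+m t (suc n₀)) b≤x
            n₀<   = subst (_≤ x ∸ t) (m+n∸n≡m (suc n₀) t) (∸-monoˡ-≤ t b≤x)
            r , p = rec (∸-monoʳ-< 1≤t t≤x)
        in r , ~-trans T p (~-sym T (subst (λ y → SameFactor α T y (x ∸ t)) (m∸n+n≡m t≤x)
                                      (sameFactor-+period per T n₀<)))

-- Classical counting of classes.

module Classical (em : ExcludedMiddle 0ℓ) where

  -- A position equivalent to no member could be added to the family, against its maximality.
  separated-maximal⇒covering : ∀ {R c} → Symmetric R → ((f , _) : Separated R c) →
                               ¬ Separated R (suc c) → ∀ y → ∃[ x ] R (f x) y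
  separated-maximal⇒covering {R} sym-R sep ¬sep y = decidable-stable em λ ¬∃ →
    ¬sep (separated-∷ {R} sym-R sep y λ x r → ¬∃ (x , r))

  -- The class of i and j splits, so one of i, j can be added to representatives
  -- of the classes: if it is already represented, add the one of i, j that is no
  -- longer equivalent to its representative.
  agree-refine : ∀ {P D D′ m i j c} → D ⊆ D′ → D′ m →
                 Agree P D i j → ¬ (P m i ⇔ P m j) →
                 Separated (Agree P D) c → Separated (Agree P D′) (suc c)
  agree-refine {P} {D} {D′} {m} {i} {j} D⊆D′ m∈D′ i~j i≁j sep@(f , inj) =
    case em of λ where
      (no ¬∃)        → add i λ x r → ¬∃ (x , coarsen r)
      (yes (x , x~i)) → case em of λ where
        (no ¬r) → extend x i x~i ¬r
        (yes r) → extend x j (agree-trans x~i i~j) λ r′ →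
                    i≁j (at (agree-trans (agree-sym r) r′) m m∈D′)
    where
    coarsen : Agree P D′ ⇒ Agree P D
    coarsen r = agree λ l l∈D → at r l (D⊆D′ l∈D)
    add : ∀ y → (∀ x → ¬ Agree P D′ (f x) y) → Separated (Agree P D′) _
    add = separated-∷ {Agree P D′} agree-sym (separated-mono {Agree P D} coarsen sep)
    extend : ∀ x y → Agree P D (f x) y → ¬ Agree P D′ (f x) y → Separated (Agree P D′) _
    extend x y x~y x≁y = add y λ z r → case inj (agree-trans x~y (agree-sym (coarsen r))) of
      λ { refl → x≁y r }

  -- The search stops where `Q` first fails above `n`. This gives the true maximum once `Q` is
  -- downward closed, which `separated-≤` provides where the lemma is applied.
  largest : ∀ (Q : ℕ → Set) {n} → Q n → ∀ fuel → ¬ Q (fuel + n) →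
            ∃[ m ] n ≤ m × Q m × ¬ Q (suc m)
  largest Q q zero ¬q = contradiction q ¬q
  largest Q {n} q (suc fuel) ¬q with em {Q (suc n)}
  ... | no ¬q′ = n , ≤-refl , q , ¬q′
  ... | yes q′ =
    let m , 1+n≤m , rest = largest Q q′ fuel (subst (¬_ ∘ Q) (sym (+-suc fuel n)) ¬q)
    in m , ≤-trans (n≤1+n n) 1+n≤m , rest

  truth : Set → Fin 2
  truth A = case em {A} of λ where
    (yes _) → suc zero
    (no _)  → zero

  truth-reflects : ∀ {A B} → truth A ≡ truth B → A ⇔ B
  truth-reflects {A} {B} eq with em {A} | em {B}
  ... | yes a | yes b = mk⇔ (λ _ → b) (λ _ → a)
  ... | no ¬a | no ¬b = mk⇔ (λ a → contradiction a ¬a) (λ b → contradiction b ¬b)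
  truth-reflects () | yes _ | no _
  truth-reflects () | no _ | yes _

  funToFin-reflects : ∀ {m n} (f g : Fin m → Fin n) → funToFin f ≡ funToFin g → ∀ i → f i ≡ g i
  funToFin-reflects f g eq i = trans (sym (Fin.finToFun-funToFin f i))
    (trans (cong (λ c → finToFun c i) eq) (Fin.finToFun-funToFin g i))

  -- Finiteness of factor counts and attainment of their maximum.

  module _ (α : InfinitePermutation) where
    open Permutation α renaming (trans to ≺-trans)

    -- A factor is encoded by a `k` by `k` table of truth values. The bound is crude, but only
    -- finiteness matters.
    factor-bound : ∀ {k} (T : Window k) {c} → Separated (SameFactor α T) c → c ≤ (2 ^ k) ^ k
    factor-bound {k} T = separated-bounded {SameFactor α T} (λ n → funToFin (row n)) λ {i} {j} eq a b →
      truth-reflects (funToFin-reflects _ _ (funToFin-reflects (row i) (row j) eq a) b)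
      where
      row : ℕ → Fin k → Fin (2 ^ k)
      row n a = funToFin λ b → truth (Permutation._≺_ (factor α T n) a b)

    -- Take the largest `m` such that some window has `m` pairwise distinct factors. Maximality
    -- makes these exhaust the factors of that window, so its complexity is exactly `m`, and no
    -- other window exceeds it.
    maximalPatternComplexity : ∀ {n} → ∃ (λ (T : Window n) → Separated (SameFactor α T) n) →
                               ∃[ m ] (MaximalPatternComplexity α n m × n ≤ m)
    maximalPatternComplexity {n} attained
      with largest (λ c → ∃ λ (T : Window n) → Separated (SameFactor α T) c) attained
             -- Starting from `n`, this much fuel leads past the bound on factor counts.
             (suc ((2 ^ n) ^ n))
             (λ (T , sep) → <⇒≱ (m≤m+n (suc ((2 ^ n) ^ n)) n) (factor-bound T sep))
    ... | m , n≤m , (T , sep@(f , inj)) , ¬sep = m , ((T , count) , bound) , n≤m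
      where
      module ~ = Setoid (factorSetoid α T)
      covering : ∀ y → ∃[ x ] SameFactor α T (f x) y
      covering = separated-maximal⇒covering (λ {i} {j} → ~.sym {i} {j}) sep λ sep′ → ¬sep (T , sep′)
      count : PatternComplexity α T m
      count = record
        { to        = f
        ; cong      = λ { {x} refl → ~.refl {f x} }
        ; bijective = inj , λ y → let x , r = covering y in x , λ { refl → r }
        }
      bound : ∀ (T′ : Window n) c → PatternComplexity α T′ c → c ≤ m
      bound T′ c b = ≮⇒≥ λ m<c →
        ¬sep (T′ , separated-≤ {SameFactor α T′} m<c (separated-bijection {α = α} {T′} b))

    -- Rows, and a window that determines them.

    Row : ℕ → ℕ → Set
    Row m i = i ≺ (m + i)

    -- As `0` lies in the window, the factor at `i` records the comparison of `i` with `m + i` for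
    -- each `m` in it. Hence distinct restricted rows give distinct factors.
    sameFactor⇒row : ∀ {k} (W : Window k) → SameFactor α W ⇒ Agree Row (_∈ʷ W)
    sameFactor⇒row W {i} {j} r with Window.contains-0 W
    ... | z , z≡0 = agree λ { _ (a , refl) → subst (λ w → ((w + i) ≺ (Window.elem W a + i)) ⇔
                                 ((w + j) ≺ (Window.elem W a + j))) z≡0 (r z a) }

    row-0 : ∀ {i j} → Row 0 i ⇔ Row 0 j
    row-0 = mk⇔ (λ p → contradiction p (irrefl refl)) (λ p → contradiction p (irrefl refl))

    Determining : ∀ {k} → Window k → Set
    Determining W = ∀ i j → Agree Row (_∈ʷ W) i j → ∀ m → Row m i ⇔ Row m j

    -- Adding an index that splits a class costs one element and gains at least one class, so
    -- classes keep up with elements. If nothing splits, the current window determines all rows.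
    determining-or-separated : ∀ k →
      ∃ (λ l → ∃ λ (W : Window l) → Determining W) ⊎
      ∃ (λ (W : Window (suc k)) → Separated (Agree Row (_∈ʷ W)) (suc k))
    determining-or-separated zero =
      inj₂ (singleton-window , (λ _ → 0) , λ { {zero} {zero} _ → refl })
    determining-or-separated (suc k) with determining-or-separated k
    ... | inj₁ det = inj₁ det
    ... | inj₂ (W , sep)
      with em {∃[ i ] ∃[ j ] ∃[ m ] Agree Row (_∈ʷ W) i j × ¬ (Row m i ⇔ Row m j)}
    ... | no ¬split = inj₁ (_ , W , λ i j r m → decidable-stable em λ d →
                              ¬split (i , j , m , r , d))
    ... | yes (i , j , m , r , d) =
      let W′ , W⊆W′ , m∈W′ = insert-window W m λ m∈W → d (at r m m∈W)
      in inj₂ (W′ , agree-refine W⊆W′ m∈W′ r d sep)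

    -- The Morse-Hedlund argument along progressions of difference `d`.

    module _ (d : ℕ) .{{_ : NonZero d}} where

      -- The word of `i` lists the comparisons of consecutive terms of the progression from `i`;
      -- moving `i` by `d` drops its first letter.
      Step : ℕ → ℕ → Set
      Step l i = (l * d + i) ≺ (suc l * d + i)

      step-+ : ∀ l i → Step l (d + i) ≡ Step (suc l) i
      step-+ l i = cong₂ _≺_ (+-shift l) (+-shift (suc l))
        where
        +-shift : ∀ l → l * d + (d + i) ≡ suc l * d + i
        +-shift l = trans (sym (+-assoc (l * d) d i)) (cong (_+ i) (+-comm (l * d) d))

      sameFactor⇒step : ∀ k → SameFactor α (arithmetic-window k d) ⇒ Agree Step (_< k)
      sameFactor⇒step k {i} {j} r = agree λ l l<k →
        subst₂ (λ x y → ((x * d + i) ≺ (y * d + i)) ⇔ ((x * d + j) ≺ (y * d + j)))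
          (Fin.toℕ-fromℕ< (m<n⇒m<1+n l<k)) (Fin.toℕ-fromℕ< (s≤s l<k))
          (r (fromℕ< (m<n⇒m<1+n l<k)) (fromℕ< (s≤s l<k)))

      StepDetermining : ℕ → Set
      StepDetermining k = ∀ i j → Agree Step (_< k) i j → Step k i ⇔ Step k j

      -- Each further letter either creates a class or is determined by the earlier ones. Length `k`
      -- is matched with `k + 1` classes because a window of `k + 1` terms has `k` consecutive
      -- comparisons.
      stepDetermining-or-separated : ∀ k →
        ∃ (λ l → l ≤ k × StepDetermining l) ⊎ Separated (Agree Step (_< k)) (suc k)
      stepDetermining-or-separated zero = inj₂ ((λ _ → 0) , λ { {zero} {zero} _ → refl })
      stepDetermining-or-separated (suc k) with stepDetermining-or-separated k
      ... | inj₁ (l , l≤k , det) = inj₁ (l , ≤-trans l≤k (n≤1+n k) , det)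
      ... | inj₂ sep
        with em {∃[ i ] ∃[ j ] Agree Step (_< k) i j × ¬ (Step k i ⇔ Step k j)}
      ... | no ¬split = inj₁ (k , n≤1+n k , λ i j r → decidable-stable em λ d →
                                ¬split (i , j , r , d))
      ... | yes (i , j , r , d) =
        inj₂ (agree-refine m<n⇒m<1+n ≤-refl r d sep)

      module _ {k n} (det : StepDetermining k) (¬sep : ¬ Separated (Agree Step (_< k)) n) where

        agree-suc : ∀ {i j} → Agree Step (_< k) i j → Agree Step (_< suc k) i j
        agree-suc {i} {j} r = agree λ l l<1+k → case m<1+n⇒m<n∨m≡n l<1+k of λ where
          (inj₁ l<k)  → at r l l<k
          (inj₂ refl) → det i j r

        -- The determined next letter makes up for the one that the shift drops.
        agree-shift : ∀ {i j} → Agree Step (_< k) i j → Agree Step (_< k) (d + i) (d + j)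
        agree-shift {i} {j} r = agree λ l l<k →
          subst₂ _⇔_ (sym (step-+ l i)) (sym (step-+ l j)) (at (agree-suc r) (suc l) (s≤s l<k))

        agree-shift-* : ∀ q {i j} → Agree Step (_< k) i j →
                        Agree Step (_< k) (q * d + i) (q * d + j)
        agree-shift-* zero    r = r
        agree-shift-* (suc q) {i} {j} r =
          subst₂ (Agree Step (_< k)) (sym (+-assoc d (q * d) i)) (sym (+-assoc d (q * d) j))
            (agree-shift (agree-shift-* q r))

        -- Pigeonhole on the first `n` terms of the progression from `c`, as there are fewer than
        -- `n` classes.
        collision : ∀ c → ∃ λ (p : Fin n) → ∃ λ (q : Fin n) →
                    p <ᶠ q × Agree Step (_< k) (toℕ p * d + c) (toℕ q * d + c)
        collision c = decidable-stable em λ ¬∃ → ¬sep ((λ p → toℕ p * d + c) , λ {p} {q} r →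
          case Fin.<-cmp p q of λ where
            (tri< p<q _ _) → contradiction (p , q , p<q , r) ¬∃
            (tri≈ _ p≡q _) → p≡q
            (tri> _ _ q<p) → contradiction (q , p , q<p , agree-sym r) ¬∃)

        -- Write `i` as `n * d + c` and let terms `p < q` of the progression from `c` collide.
        -- Moving both forward by `n - p` steps takes the first to `i` and the second to
        -- `(q - p) * d + i`.
        agree-return : ∀ i → n * d ≤ i →
                       ∃[ e ] 1 ≤ e × e ≤ n × Agree Step (_< k) i (e * d + i)
        agree-return i nd≤i
          with c , refl ← m≤n⇒∃[o]m+o≡n nd≤i
          with p , q , p<q , r ← collision c
          with e , 1+p+e≡q ← m≤n⇒∃[o]m+o≡n p<q
          with g , p+g≡n ← m≤n⇒∃[o]m+o≡n (<⇒≤ (Fin.toℕ<n p)) =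
          -- Here `suc e` is `q - p` and `g` is `n - p`.
          suc e , s≤s z≤n , ≤-trans 1+e≤q (<⇒≤ (Fin.toℕ<n q)) ,
          subst₂ (Agree Step (_< k)) left right (agree-shift-* g r)
          where
          open ≡-Reasoning
          1+e≤q : suc e ≤ toℕ q
          1+e≤q = subst (suc e ≤_) 1+p+e≡q (s≤s (m≤n+m e (toℕ p)))
          rearrange : ∀ g p d c → g * d + (p * d + c) ≡ (p + g) * d + c
          rearrange = solve-∀
          rearrange′ : ∀ g p e d c →
            g * d + ((1 + p + e) * d + c) ≡ (1 + e) * d + ((p + g) * d + c)
          rearrange′ = solve-∀
          left : g * d + (toℕ p * d + c) ≡ n * d + c
          left = trans (rearrange g (toℕ p) d c) (cong (λ x → x * d + c) p+g≡n)
          right : g * d + (toℕ q * d + c) ≡ suc e * d + (n * d + c)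
          right = begin
            g * d + (toℕ q * d + c)                 ≡⟨ cong (λ x → g * d + (x * d + c)) 1+p+e≡q ⟨
            g * d + ((1 + toℕ p + e) * d + c)       ≡⟨ rearrange′ g (toℕ p) e d c ⟩
            (1 + e) * d + ((toℕ p + g) * d + c)     ≡⟨ cong (λ x → suc e * d + (x * d + c)) p+g≡n ⟩
            suc e * d + (n * d + c)                 ∎

        agree-iterate : ∀ r e {i} → Agree Step (_< k) i (e * d + i) →
                        Agree Step (_< k) i (r * (e * d) + i)
        agree-iterate zero    e a = agree λ l _ → ⇔-id _
        agree-iterate (suc r) e {i} a = agree-trans a
          (subst (Agree Step (_< k) (e * d + i)) (sym (+-assoc (e * d) (r * (e * d)) i))
            (agree-shift-* e (agree-iterate r e a)))

        -- The return distance `e * d` varies with `i` but never exceeds `n * d ≤ N`, so it divides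
        -- `N !`, which is therefore a period for all `i` at once.
        row-periodic : ∀ {N i} → n * d ≤ N → N ≤ i → Row d i ⇔ Row d (N ! + i)
        row-periodic {N} {i} nd≤N N≤i
          with e , 1≤e , e≤n , a ← agree-return i (≤-trans nd≤N N≤i)
          with divides r N!≡ ← ∣! {m = e * d} {N} (*-mono-≤ 1≤e (>-nonZero⁻¹ d))
                                 (≤-trans (*-monoˡ-≤ d e≤n) nd≤N) =
          subst (λ x → (i ≺ (x + i)) ⇔ ((N ! + i) ≺ (x + (N ! + i)))) (+-identityʳ d)
            (at (agree-suc (subst (λ t → Agree Step (_< k) i (t + i)) (sym N!≡) (agree-iterate r e a)))
              0 z<s)

    -- Few factors force ultimate periodicity.

    module _ (k : ℕ) (¬sep : ∀ (T : Window (suc k)) → ¬ Separated (SameFactor α T) (suc k)) where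

      fewFactors⇒row-periodic : ∀ d {N i} → suc k * d ≤ N → N ≤ i → Row d i ⇔ Row d (N ! + i)
      fewFactors⇒row-periodic zero      _ _ = row-0
      fewFactors⇒row-periodic d@(suc _) h N≤i with stepDetermining-or-separated d k
      ... | inj₂ sep = contradiction
        (separated-mono {S = SameFactor α T} (λ {i} {j} → sameFactor⇒step d k {i} {j}) sep) (¬sep T)
        where T = arithmetic-window k d
      -- Agreement on `l ≤ k` letters is coarser than agreement on `k`, so it too has fewer than
      -- `suc k` classes.
      ... | inj₁ (l , l≤k , det) = row-periodic d det (λ sep → ¬sep T
        (separated-mono {S = SameFactor α T}
          (λ {i} {j} r → agree λ m m<l → at (sameFactor⇒step d k {i} {j} r) m (≤-trans m<l l≤k)) sep))
        h N≤i
        where T = arithmetic-window k d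

      fewFactors⇒rows-periodic : ∃[ N ] (∀ i → N ≤ i → ∀ m → Row m i ⇔ Row m (N ! + i))
      fewFactors⇒rows-periodic with determining-or-separated k
      ... | inj₂ (W , sep) = contradiction
        (separated-mono {S = SameFactor α W} (λ {i} {j} → sameFactor⇒row W {i} {j}) sep) (¬sep W)
      ... | inj₁ (_ , W , det) with sequence-bounded (Window.elem W)
      -- `L` bounds every difference in the window, so the one period `N !` with `N = suc k * L`
      -- serves them all, and `det` extends it to whole rows.
      ... | L , W≤L = suc k * L , λ i N≤i → det i _ (agree λ where
        _ (a , refl) → fewFactors⇒row-periodic (Window.elem W a) (*-monoʳ-≤ (suc k) (W≤L a)) N≤i)

      fewFactors⇒ultimatelyPeriodic : UltimatelyPeriodic α
      fewFactors⇒ultimatelyPeriodic with fewFactors⇒rows-periodic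
      ... | N , rows = N ! , 1≤n! N , N , λ i j i≢j N<i N<j → case <-cmp i j of λ where
          (tri< i<j _ _) → ascending i j i<j (<⇒≤ N<i)
          (tri≈ _ i≡j _) → contradiction i≡j i≢j
          (tri> _ _ j<i) → flip i≢j (ascending j i j<i (<⇒≤ N<j))
        where
        t = N !
        ascending : ∀ i j → i < j → N ≤ i → (i ≺ j) ⇔ ((i + t) ≺ (j + t))
        ascending i j i<j N≤i =
          subst₂ (λ x y → (i ≺ x) ⇔ ((i + t) ≺ y)) (m∸n+n≡m (<⇒≤ i<j))
            (trans (sym (+-assoc (j ∸ i) i t)) (cong (_+ t) (m∸n+n≡m (<⇒≤ i<j))))
            (subst (λ x → (i ≺ (j ∸ i + i)) ⇔ (x ≺ (j ∸ i + x))) (+-comm t i) (rows i N≤i (j ∸ i)))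
        -- Rows compare an index only with later ones; for a descending pair, totality turns the
        -- equivalence for `j ≺ i` into the one for `i ≺ j`.
        flip : ∀ {i j} → i ≢ j → (j ≺ i) ⇔ ((j + t) ≺ (i + t)) → (i ≺ j) ⇔ ((i + t) ≺ (j + t))
        flip {i} {j} i≢j e = mk⇔ to′ from′
          where
          open Equivalence e
          to′ : i ≺ j → (i + t) ≺ (j + t)
          to′ i≺j with compare (i + t) (j + t)
          ... | tri< p _ _ = p
          ... | tri≈ _ p _ = contradiction (+-cancelʳ-≡ t i j p) i≢j
          ... | tri> _ _ p = contradiction (≺-trans i≺j (from p)) (irrefl refl)
          from′ : (i + t) ≺ (j + t) → i ≺ j
          from′ it≺jt with compare i j
          ... | tri< p _ _ = p
          ... | tri≈ _ p _ = contradiction p i≢j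
          ... | tri> _ _ p = contradiction (≺-trans it≺jt (to p)) (irrefl refl)

theorem4 : ExcludedMiddle 0ℓ → (α : InfinitePermutation) →
    (¬ UltimatelyPeriodic α) ⇔
    (∀ (n : ℕ) → 1 ≤ n → ∃[ m ] (MaximalPatternComplexity α n m × n ≤ m))
theorem4 em α = mk⇔ to′ from′
  where
  open Classical em
  to′ : ¬ UltimatelyPeriodic α →
        ∀ n → 1 ≤ n → ∃[ m ] (MaximalPatternComplexity α n m × n ≤ m)
  to′ ¬per (suc k) _ = maximalPatternComplexity α (decidable-stable em λ ¬∃ →
    ¬per (fewFactors⇒ultimatelyPeriodic α k λ T sep → ¬∃ (T , sep)))
  from′ : (∀ n → 1 ≤ n → ∃[ m ] (MaximalPatternComplexity α n m × n ≤ m)) →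
          ¬ UltimatelyPeriodic α
  from′ large per with periodic⇒bounded α per
  -- Some window of `suc b` elements has at least `suc b` factors, while `b` bounds the count for
  -- windows of every size.
  ... | b , bounded with large (suc b) (s≤s z≤n)
  ... | m , ((T , count) , _) , b<m =
    <⇒≱ b<m (bounded T (separated-bijection {α = α} {T} count))
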